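{- Let $\alpha_1,\alpha_2,\alpha_3\ge 0$, $\beta_1,\beta_2,\beta_3>0$ and $Q>0$ be real numbers. Braess' paradox occurs in the symmetrical network configuration $S/S^+$ with these parameters and total flow $Q$ (i.e. $T^+_{Eq}>T_{Eq}$) if and only if $\beta_1>\beta_2$ and $$\frac{2(\alpha_2-\alpha_1-\alpha_3)}{3\beta_1+2\beta_3-\beta_2}<Q<\frac{2(\alpha_2-\alpha_1-\alpha_3)}{\beta_1-\beta_2}.$$
   Context: The network $S^+$ has nodes $a,b,c,d$ and directed links $(a,b),(b,d),(b,c),(a,c),(c,d)$ with travel times $\alpha_1+\beta_1f_{ab}$, $\alpha_2+\beta_2f_{bd}$, $\alpha_3+\beta_3f_{bc}$, $\alpha_2+\beta_2f_{ac}$, $\alpha_1+\beta_1f_{cd}$ respectively, where $f_{ij}\ge 0$ is the (real) flow on link $(i,j)$ and $\alpha_i\ge 0$, $\beta_i>0$. All traffic, of total amount $Q>0$ (real), goes from $a$ to $d$ along the paths $P_1=a-b-d$, $P_2=a-c-d$, $P_3=a-b-c-d$. The network $S$ is $S^+$ with the link $(b,c)$ removed, so its paths are $P_1,P_2$ only. A flow assigns a non-negative real amount to each path, with total $Q$; the flow on a link is the sum of the flows of the paths containing it; the travel time on a path is the sum of the travel times of its links. A path has vanishing flow if its path flow is $0$. A network is at equilibrium if all paths with non-vanishing flow have the same travel time, and every path with vanishing flow has travel time at least this common value. The equilibrium exists and is unique; its common travel time is denoted $T_{Eq}$ for $S$ and $T^+_{Eq}$ for $S^+$. Braess' paradox is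 said to occur in $S/S^+$ for the total flow $Q$ if $T^+_{Eq}>T_{Eq}$. -}

module Defs where

open import Algebra.Apartness.Bundles using (HeytingField)
open import Algebra.Bundles using (CommutativeRing)
open import Data.Bool.Base using (if_then_else_)
open import Data.Fin.Base using (Fin)
open import Data.Fin.Patterns using (0F; 1F; 2F; 3F; 4F)
open import Data.List.Base using (List; []; _∷_; map; foldr; filter; length; lookup)
open import Data.Nat.Base as ℕ using (ℕ)
open import Data.Product.Base using (∃-syntax; _×_; proj₁)
open import Data.Sum.Base using (_⊎_)
open import Data.Vec.Functional using (Vector)
open import Level using (Level; _⊔_; suc)
open import Relation.Binary.Core using (Rel)
open import Relation.Binary.Structures using (IsStrictPartialOrder)
open import Relation.Binary.Lattice.Structures using (IsLattice)
open import Relation.Nullary using (¬_; ¬?; does)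
import Algebra.Definitions.RawMonoid as RawMonoidDefinitions
import Data.Fin.Properties as Fin
import Data.List.Membership.DecPropositional as DecMembership
import Relation.Binary.Reasoning.Setoid as ≈-Reasoning

-- The real numbers, axiomatised as a Cauchy complete Archimedean ordered
-- field.  The axioms are those satisfied by constructive reals: the order is
-- not assumed decidable, x ≤ y means that y < x fails, and an inverse is
-- available for elements apart from 0.  Classically, every model is isomorphic
-- to ℝ.

record OrderedField c ℓ₁ ℓ₂ : Set (suc (c ⊔ ℓ₁ ⊔ ℓ₂)) where
  infix 4 _<_ _≤_
  infixl 6 _∨_
  infixl 7 _∧_

  field
    heytingField : HeytingField c ℓ₁ ℓ₂

  open HeytingField heytingField public

  field
    _<_ : Rel Carrier ℓ₂

  _≤_ : Rel Carrier ℓ₂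
  x ≤ y = ¬ (y < x)

  field
    _∨_ _∧_              : Carrier → Carrier → Carrier
    isStrictPartialOrder : IsStrictPartialOrder _≈_ _<_
    #⇒<⊎>                : ∀ {x y} → x # y → x < y ⊎ y < x
    <⇒#                  : ∀ {x y} → x < y → x # y
    +-monoˡ-<            : ∀ z {x y} → x < y → x + z < y + z
    *-pos                : ∀ {x y} → 0# < x → 0# < y → 0# < x * y
    isLattice            : IsLattice _≈_ _≤_ _∨_ _∧_

  open IsStrictPartialOrder isStrictPartialOrder public
    using (<-respʳ-≈; <-respˡ-≈)
    renaming (irrefl to <-irrefl; trans to <-trans; asym to <-asym)

  commutativeRing : CommutativeRing c ℓ₁
  commutativeRing = record { isCommutativeRing = isCommutativeRing }

  open CommutativeRing commutativeRing public using (+-rawMonoid)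

  open RawMonoidDefinitions +-rawMonoid public
    using (sum)
    renaming (_×_ to infixr 8 _·_)

  infixl 7 _/_⟨_⟩

  -- #⇒invertible inverts y - 0#, which is equal to y.
  _/_⟨_⟩ : (x y : Carrier) → y # 0# → Carrier
  x / y ⟨ y#0 ⟩ = x * proj₁ (#⇒invertible y#0)

  x<y⇒0<y-x : ∀ {x y} → x < y → 0# < y - x
  x<y⇒0<y-x {x} x<y = <-respˡ-≈ (-‿inverseʳ x) (+-monoˡ-< (- x) x<y)

  0<x+y : ∀ {x y} → 0# < x → 0# < y → 0# < x + y
  0<x+y {y = y} 0<x 0<y = <-trans 0<y (<-respˡ-≈ (+-identityˡ y) (+-monoˡ-< y 0<x))

  0<2·x : ∀ {x} → 0# < x → 0# < 2 · x
  0<2·x {x} 0<x = 0<x+y 0<x (<-respʳ-≈ (sym (+-identityʳ x)) 0<x)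

  x<y⇒y-x#0 : ∀ {x y} → x < y → y - x # 0#
  x<y⇒y-x#0 x<y = #-sym (<⇒# (x<y⇒0<y-x x<y))

  3·x+2·z-y#0 : ∀ {x y z} → 0# < x → 0# < z → y < x → 3 · x + 2 · z - y # 0#
  3·x+2·z-y#0 {x} {y} {z} 0<x 0<z y<x = #-sym (<⇒# (<-respʳ-≈ eq
    (0<x+y (x<y⇒0<y-x y<x) (0<x+y (0<2·x 0<x) (0<2·x 0<z)))))
    where
    open ≈-Reasoning setoid
    w = 2 · x + 2 · z
    eq : (x - y) + w ≈ 3 · x + 2 · z - y
    eq = begin
      (x - y) + w          ≈⟨ +-assoc x (- y) w ⟩
      x + (- y + w)        ≈⟨ +-congˡ (+-comm (- y) w) ⟩
      x + (w - y)          ≈⟨ +-assoc x w (- y) ⟨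
      (x + w) - y          ≈⟨ +-congʳ (+-assoc x (2 · x) (2 · z)) ⟨
      3 · x + 2 · z - y    ∎

record Reals c ℓ₁ ℓ₂ : Set (suc (c ⊔ ℓ₁ ⊔ ℓ₂)) where
  field
    orderedField : OrderedField c ℓ₁ ℓ₂

  open OrderedField orderedField public

  -- The symmetry in m and n makes an absolute value unnecessary.
  IsCauchy : (ℕ → Carrier) → Set (c ⊔ ℓ₂)
  IsCauchy s = ∀ ε → 0# < ε →
    ∃[ N ] (∀ m n → N ℕ.≤ m → N ℕ.≤ n → s m - s n < ε)

  _ConvergesTo_ : (ℕ → Carrier) → Carrier → Set (c ⊔ ℓ₂)
  s ConvergesTo l = ∀ ε → 0# < ε →
    ∃[ N ] (∀ n → N ℕ.≤ n → (s n - l < ε) × (l - s n < ε))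

  field
    archimedean : ∀ x → ∃[ n ] (x < n · 1#)
    complete    : ∀ s → IsCauchy s → ∃[ l ] (s ConvergesTo l)

-- The link xy leads from node x to node y; a path is the list of its links.
Link : Set
Link = Fin 5

pattern ab = 0F
pattern bd = 1F
pattern bc = 2F
pattern ac = 3F
pattern cd = 4F

open DecMembership (Fin._≟_ {5}) using (_∈?_)

-- A network is given by its list of paths from a to d.
Network : Set
Network = List (List Link)

S⁺ : Network
S⁺ = (ab ∷ bd ∷ []) ∷ (ac ∷ cd ∷ []) ∷ (ab ∷ bc ∷ cd ∷ []) ∷ []

S : Network
S = filter (λ P → ¬? (bc ∈? P)) S⁺

Path : Network → Set
Path N = Fin (length N)

module Traffic {c ℓ₁ ℓ₂} (ℝ : Reals c ℓ₁ ℓ₂)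
               (α₁ α₂ α₃ β₁ β₂ β₃ : Reals.Carrier ℝ) where

  open Reals ℝ

  linkTime : Link → Carrier → Carrier
  linkTime ab f = α₁ + β₁ * f
  linkTime bd f = α₂ + β₂ * f
  linkTime bc f = α₃ + β₃ * f
  linkTime ac f = α₂ + β₂ * f
  linkTime cd f = α₁ + β₁ * f

  module _ (N : Network) where

    PathFlow : Set c
    PathFlow = Vector Carrier (length N)

    IsFlow : Carrier → PathFlow → Set (ℓ₁ ⊔ ℓ₂)
    IsFlow Q f = (∀ p → 0# ≤ f p) × sum f ≈ Q

    linkFlow : PathFlow → Link → Carrier
    linkFlow f e = sum λ p → if does (e ∈? lookup N p) then f p else 0#

    pathTime : PathFlow → Path N → Carrier
    pathTime f p =
      foldr _+_ 0# (map (λ e → linkTime e (linkFlow f e)) (lookup N p))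

    -- When Q > 0 some path has non-vanishing flow, so f determines T.
    IsEquilibrium : Carrier → PathFlow → Carrier → Set (ℓ₁ ⊔ ℓ₂)
    IsEquilibrium Q f T =
      IsFlow Q f ×
      (∀ p → ¬ (f p ≈ 0#) → pathTime f p ≈ T) ×
      (∀ p → f p ≈ 0# → T ≤ pathTime f p)

    -- The equilibrium travel time, as a definite description: it exists and is
    -- the same for every equilibrium flow.
    IsEquilibriumTime : Carrier → Carrier → Set (c ⊔ ℓ₁ ⊔ ℓ₂)
    IsEquilibriumTime Q T =
      (∃[ f ] IsEquilibrium Q f T) ×
      (∀ f T′ → IsEquilibrium Q f T′ → T′ ≈ T)

  BraessParadox : Carrier → Set (c ⊔ ℓ₁ ⊔ ℓ₂)
  BraessParadox Q =
    ∃[ T ] ∃[ T⁺ ]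
      (IsEquilibriumTime S Q T × IsEquilibriumTime S⁺ Q T⁺ × T < T⁺)

{-# OPTIONS --safe #-}

-- The path times are strictly monotone functions of the flow (the sum of
-- Δf_p * Δt_p over the paths is a positive combination of squares), so the
-- equilibrium is unique.  On S it splits Q evenly.  On S⁺ let y be the flow on
-- P₃, let t₀, t₁, t₂ be the times on P₁, P₂, P₃, and let T be the equilibrium
-- time on S.  Then
--
--   t₀ + t₁ = 2 T + (β₁ - β₂) y,
--   (β₁ - β₂) Q + (β₁ + β₂ + 2 β₃) y + (t₀ + t₁) = 2 (α₂ - α₁ - α₃) + 2 t₂.
--
-- Since T⁺ ≤ t₀, t₁, the first one shows that T < T⁺ needs β₂ < β₁ and 0 < y,
-- whence T⁺ = t₂; the bounds on Q follow from the two identities by t₂ ≤ t₀, t₁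
-- and by y ≤ Q.  Conversely, the bounds make the y determined by t₀ = t₁ = t₂,
-- cut off at Q, positive and large enough for T < t₂.

module Submission where

open import Defs
open import Algebra.Bundles using (CommutativeRing)
open import Algebra.Solver.Ring.AlmostCommutativeRing
  using (fromCommutativeRing; _-Raw-AlmostCommutative⟶_)
open import Data.Bool.Base using (true; false; if_then_else_)
open import Data.Empty using (⊥-elim)
open import Data.Fin.Base using (zero; suc)
open import Data.Fin.Patterns using (0F; 1F; 2F)
open import Data.Integer.Base as ℤ using (ℤ; -[1+_]; _⊖_) renaming (+_ to pos)
open import Data.List.Base using (List; []; _∷_; map; foldr; lookup)
open import Data.Nat.Base as ℕ using (zero; suc)
open import Data.Product.Base using (Σ-syntax; ∃-syntax; _×_; _,_; proj₁; proj₂)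
open import Data.Sum.Base using (_⊎_; inj₁; inj₂; [_,_]′)
open import Data.Vec.Functional using (Vector)
open import Function.Base using (_∘_)
open import Function.Bundles using (_⇔_; mk⇔; module Equivalence)
open import Relation.Nullary using (¬_; does)
open import Relation.Nullary.Decidable using (dec⇒maybe)
import Algebra.Apartness.Properties.HeytingCommutativeRing as HeytingProperties
import Algebra.Properties.AbelianGroup as AbelianGroupProperties
import Algebra.Properties.CommutativeSemigroup as CommutativeSemigroupProperties
import Algebra.Properties.Ring as RingProperties
import Algebra.Properties.Semiring.Mult as Mult
import Algebra.Properties.Semiring.Sum as Sum
import Algebra.Solver.Ring
import Data.Fin.Properties as Fin
import Data.Integer.Properties as ℤ
import Data.List.Membership.DecPropositional as DecMembership
import Data.Maybe.Base as Maybe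
import Relation.Binary.Lattice.Structures as Lattice
import Relation.Binary.PropositionalEquality.Core as ≡
import Relation.Binary.Reasoning.Base.Triple as Triple
import Relation.Binary.Reasoning.Setoid as ≈-Reasoning

-- An abstract ring has no decidable equality, so for the solver to cancel
-- terms its coefficients have to be integers.
module IntegerCoefficientSolver {c ℓ} (R : CommutativeRing c ℓ) where

  open CommutativeRing R
  open RingProperties ring using (-0#≈0#; -‿distribˡ-*; -‿distribʳ-*; -‿involutive)
  open AbelianGroupProperties +-abelianGroup using (⁻¹-∙-comm)
  open CommutativeSemigroupProperties +-commutativeSemigroup using (interchange)
  open Mult semiring using (×-homo-+; ×1-homo-*) renaming (_×_ to _·_)
  open ≈-Reasoning setoid

  fromℤ : ℤ → Carrier
  fromℤ (pos n)  = n · 1#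
  fromℤ -[1+ n ] = - (suc n · 1#)

  fromℤ-⊖ : ∀ m n → fromℤ (m ⊖ n) ≈ m · 1# - n · 1#
  fromℤ-⊖ zero    zero    = sym (-‿inverseʳ 0#)
  fromℤ-⊖ zero    (suc n) = sym (+-identityˡ _)
  fromℤ-⊖ (suc m) zero    = sym (trans (+-congˡ -0#≈0#) (+-identityʳ _))
  fromℤ-⊖ (suc m) (suc n) = begin
    fromℤ (suc m ⊖ suc n)             ≡⟨ ≡.cong fromℤ (ℤ.[1+m]⊖[1+n]≡m⊖n m n) ⟩
    fromℤ (m ⊖ n)                     ≈⟨ fromℤ-⊖ m n ⟩
    m · 1# - n · 1#                   ≈⟨ +-identityˡ _ ⟨
    0# + (m · 1# - n · 1#)            ≈⟨ +-congʳ (-‿inverseʳ 1#) ⟨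
    (1# - 1#) + (m · 1# - n · 1#)     ≈⟨ interchange _ _ _ _ ⟩
    suc m · 1# + (- 1# + - (n · 1#))  ≈⟨ +-congˡ (⁻¹-∙-comm 1# (n · 1#)) ⟩
    suc m · 1# - suc n · 1#           ∎

  fromℤ-neg : ∀ i → fromℤ (ℤ.- i) ≈ - fromℤ i
  fromℤ-neg (pos zero)    = sym -0#≈0#
  fromℤ-neg (pos (suc n)) = refl
  fromℤ-neg -[1+ n ]      = sym (-‿involutive _)

  fromℤ-+ : ∀ i j → fromℤ (i ℤ.+ j) ≈ fromℤ i + fromℤ j
  fromℤ-+ (pos m)  (pos n)  = ×-homo-+ 1# m n
  fromℤ-+ (pos m)  -[1+ n ] = fromℤ-⊖ m (suc n)
  fromℤ-+ -[1+ m ] (pos n)  = trans (fromℤ-⊖ n (suc m)) (+-comm _ _)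
  fromℤ-+ -[1+ m ] -[1+ n ] = begin
    fromℤ (-[1+ m ] ℤ.+ -[1+ n ])
      ≡⟨ ≡.cong fromℤ (ℤ.neg-distrib-+ (pos (suc m)) (pos (suc n))) ⟨
    - ((suc m ℕ.+ suc n) · 1#)
      ≈⟨ -‿cong (×-homo-+ 1# (suc m) (suc n)) ⟩
    - (suc m · 1# + suc n · 1#)
      ≈⟨ ⁻¹-∙-comm _ _ ⟨
    - (suc m · 1#) - suc n · 1#
      ∎

  -- Multiplication is handled one factor at a time: a negative factor is pulled out with
  -- `fromℤ-neg`, which leaves a product of natural numbers.
  fromℤ-*-pos : ∀ i n → fromℤ (i ℤ.* pos n) ≈ fromℤ i * fromℤ (pos n)
  fromℤ-*-pos (pos m) n = begin
    fromℤ (pos m ℤ.* pos n)  ≡⟨ ≡.cong fromℤ (ℤ.pos-* m n) ⟨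
    (m ℕ.* n) · 1#           ≈⟨ ×1-homo-* m n ⟩
    (m · 1#) * (n · 1#)      ∎
  fromℤ-*-pos -[1+ m ] n = begin
    fromℤ (-[1+ m ] ℤ.* pos n)
      ≡⟨ ≡.cong fromℤ (ℤ.neg-distribˡ-* (pos (suc m)) (pos n)) ⟨
    fromℤ (ℤ.- (pos (suc m) ℤ.* pos n))
      ≈⟨ fromℤ-neg (pos (suc m) ℤ.* pos n) ⟩
    - fromℤ (pos (suc m) ℤ.* pos n)
      ≈⟨ -‿cong (fromℤ-*-pos (pos (suc m)) n) ⟩
    - ((suc m · 1#) * (n · 1#))
      ≈⟨ -‿distribˡ-* _ _ ⟩
    - (suc m · 1#) * (n · 1#)
      ∎

  fromℤ-* : ∀ i j → fromℤ (i ℤ.* j) ≈ fromℤ i * fromℤ j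
  fromℤ-* i (pos n)  = fromℤ-*-pos i n
  fromℤ-* i -[1+ n ] = begin
    fromℤ (i ℤ.* -[1+ n ])
      ≡⟨ ≡.cong fromℤ (ℤ.neg-distribʳ-* i (pos (suc n))) ⟨
    fromℤ (ℤ.- (i ℤ.* pos (suc n)))
      ≈⟨ fromℤ-neg (i ℤ.* pos (suc n)) ⟩
    - fromℤ (i ℤ.* pos (suc n))
      ≈⟨ -‿cong (fromℤ-*-pos i (suc n)) ⟩
    - (fromℤ i * (suc n · 1#))
      ≈⟨ -‿distribʳ-* _ _ ⟩
    fromℤ i * - (suc n · 1#)
      ∎

  fromℤ-homomorphism : ℤ.+-*-rawRing -Raw-AlmostCommutative⟶ fromCommutativeRing R
  fromℤ-homomorphism = record
    { ⟦_⟧    = fromℤ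
    ; +-homo = fromℤ-+
    ; *-homo = fromℤ-*
    ; -‿homo = fromℤ-neg
    ; 0-homo = refl
    ; 1-homo = +-identityʳ 1#
    }

  -- The solver needs only a sound test for equal coefficients: equal integers have equal images,
  -- and distinct ones yield no claim.
  open Algebra.Solver.Ring ℤ.+-*-rawRing (fromCommutativeRing R) fromℤ-homomorphism
    (λ i j → Maybe.map (reflexive ∘ ≡.cong fromℤ) (dec⇒maybe (i ℤ.≟ j))) public
    using (Polynomial; solve; con; _:+_; _:*_; _:-_; :-_; _:=_)

-- Order and apartness in a constructive ordered field.

module OrderedFieldProperties {c ℓ₁ ℓ₂} (F : OrderedField c ℓ₁ ℓ₂) where

  open OrderedField F hiding (zero)
  open HeytingProperties heytingCommutativeRing
    using (invertibleˡ⇒#; #-congʳ; 1#0)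
  open IntegerCoefficientSolver commutativeRing

  open Lattice.IsLattice isLattice public
    using (x∧y≤x; x∧y≤y; ∧-greatest; isPreorder)
    renaming (trans to ≤-trans; antisym to ≤-antisym; reflexive to ≤-reflexive; refl to ≤-refl)

  private variable
    w x y z : Carrier

  -- Inherited from cotransitivity of apartness. It takes the place of trichotomy below: a
  -- comparison that cannot be decided outright is decided relative to a known strict inequality.
  <-cotrans : x < y → ∀ z → x < z ⊎ z < y
  <-cotrans x<y z with #-cotrans (<⇒# x<y) z
  ... | inj₁ x#z with #⇒<⊎> x#z
  ...   | inj₁ x<z = inj₁ x<z
  ...   | inj₂ z<x = inj₂ (<-trans z<x x<y)
  <-cotrans x<y z | inj₂ z#y with #⇒<⊎> z#y
  ...   | inj₁ z<y = inj₂ z<y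
  ...   | inj₂ y<z = inj₁ (<-trans x<y y<z)

  <⇒≤ : x < y → x ≤ y
  <⇒≤ = <-asym

  <-≤-trans : x < y → y ≤ z → x < z
  <-≤-trans {z = z} x<y y≤z with <-cotrans x<y z
  ... | inj₁ x<z = x<z
  ... | inj₂ z<y = ⊥-elim (y≤z z<y)

  ≤-<-trans : x ≤ y → y < z → x < z
  ≤-<-trans {x = x} x≤y y<z with <-cotrans y<z x
  ... | inj₁ y<x = ⊥-elim (x≤y y<x)
  ... | inj₂ x<z = x<z

  module ≤-Reasoning =
    Triple isPreorder <-asym <-trans (<-respʳ-≈ , <-respˡ-≈) <⇒≤ <-≤-trans ≤-<-trans

  open ≤-Reasoning

  +-monoʳ-< : ∀ z → x < y → z + x < z + y
  +-monoʳ-< {x} {y} z x<y = begin-strict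
    z + x  ≈⟨ +-comm z x ⟩
    x + z  <⟨ +-monoˡ-< z x<y ⟩
    y + z  ≈⟨ +-comm y z ⟩
    z + y  ∎

  +-cancelʳ-< : ∀ z → x + z < y + z → x < y
  +-cancelʳ-< {x} {y} z x+z<y+z = begin-strict
    x              ≈⟨ solve 2 (λ x z → x := (x :+ z) :+ :- z) refl x z ⟩
    (x + z) - z    <⟨ +-monoˡ-< (- z) x+z<y+z ⟩
    (y + z) - z    ≈⟨ solve 2 (λ y z → (y :+ z) :+ :- z := y) refl y z ⟩
    y              ∎

  +-cancelˡ-< : ∀ z → z + x < z + y → x < y
  +-cancelˡ-< z z+x<z+y =
    +-cancelʳ-< z (<-respʳ-≈ (+-comm z _) (<-respˡ-≈ (+-comm z _) z+x<z+y))

  -- Since `≤` is a negated `<`, a violation is assumed; comparing it with the mixed sum `x + y`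
  -- blames one of the two summands.
  +-mono-≤ : w ≤ x → y ≤ z → w + y ≤ x + z
  +-mono-≤ {w} {x} {y} {z} w≤x y≤z x+z<w+y with <-cotrans x+z<w+y (x + y)
  ... | inj₁ x+z<x+y = y≤z (+-cancelˡ-< x x+z<x+y)
  ... | inj₂ x+y<w+y = w≤x (+-cancelʳ-< y x+y<w+y)

  +-mono-< : w < x → y < z → w + y < x + z
  +-mono-< w<x y<z = <-trans (+-monoˡ-< _ w<x) (+-monoʳ-< _ y<z)

  +-cancelʳ-≤ : ∀ z → x + z ≤ y + z → x ≤ y
  +-cancelʳ-≤ z x+z≤y+z = x+z≤y+z ∘ +-monoˡ-< z

  x≤x+y : 0# ≤ y → x ≤ x + y
  x≤x+y {y} {x} 0≤y = begin
    x       ≈⟨ +-identityʳ x ⟨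
    x + 0#  ≤⟨ +-mono-≤ ≤-refl 0≤y ⟩
    x + y   ∎

  x<x+y : 0# < y → x < x + y
  x<x+y {y} {x} 0<y = <-respˡ-≈ (+-identityʳ x) (+-monoʳ-< x 0<y)

  x≤y⇒0≤y-x : x ≤ y → 0# ≤ y - x
  x≤y⇒0≤y-x {x} {y} x≤y = begin
    0#     ≈⟨ -‿inverseʳ x ⟨
    x - x  ≤⟨ +-mono-≤ x≤y ≤-refl ⟩
    y - x  ∎

  0≤x+y : 0# ≤ x → 0# ≤ y → 0# ≤ x + y
  0≤x+y 0≤x 0≤y = ≤-trans 0≤x (x≤x+y 0≤y)

  x<0⇒0<-x : x < 0# → 0# < - x
  x<0⇒0<-x {x} x<0 = <-respʳ-≈ (+-identityˡ (- x)) (x<y⇒0<y-x x<0)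

  -- Apartness from zero amounts to invertibility, and an inverse of `x * y` multiplied by `x`
  -- inverts `y`.
  x*y#0⇒y#0 : x * y # 0# → y # 0#
  x*y#0⇒y#0 {x} {y} xy#0 with #⇒invertible xy#0
  ... | z , z*xy≈1 , _ = invertibleˡ⇒# (z * x , (begin-equality
    (z * x) * (y - 0#)  ≈⟨ solve 3 (λ x y z → (z :* x) :* (y :+ :- con (pos 0))
                             := z :* ((x :* y) :+ :- con (pos 0))) refl x y z ⟩
    z * (x * y - 0#)    ≈⟨ z*xy≈1 ⟩
    1#                  ∎))

  x*y#0⇒x#0 : x * y # 0# → x # 0#
  x*y#0⇒x#0 {x} {y} xy#0 = x*y#0⇒y#0 (#-congʳ (*-comm x y) xy#0)

  0≤x∧x#0⇒0<x : 0# ≤ x → x # 0# → 0# < x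
  0≤x∧x#0⇒0<x 0≤x x#0 with #⇒<⊎> x#0
  ... | inj₁ x<0 = ⊥-elim (0≤x x<0)
  ... | inj₂ 0<x = 0<x

  neg*pos : x < 0# → 0# < y → x * y < 0#
  neg*pos {x} {y} x<0 0<y = begin-strict
    x * y                ≈⟨ +-identityˡ _ ⟨
    0# + x * y           <⟨ +-monoˡ-< (x * y) (*-pos (x<0⇒0<-x x<0) 0<y) ⟩
    (- x) * y + x * y    ≈⟨ solve 2 (λ x y → (:- x) :* y :+ x :* y := con (pos 0)) refl x y ⟩
    0#                   ∎

  -- No case split on whether a factor vanishes is possible, but a negative product would make both
  -- factors apart from zero, hence positive.
  0≤x*y : 0# ≤ x → 0# ≤ y → 0# ≤ x * y
  0≤x*y 0≤x 0≤y xy<0 = <-asym xy<0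
    (*-pos (0≤x∧x#0⇒0<x 0≤x (x*y#0⇒x#0 (<⇒# xy<0)))
           (0≤x∧x#0⇒0<x 0≤y (x*y#0⇒y#0 (<⇒# xy<0))))

  0<x*y∧0≤y⇒0<x,0<y : 0# < x * y → 0# ≤ y → 0# < x × 0# < y
  0<x*y∧0≤y⇒0<x,0<y {x} {y} 0<xy 0≤y =
    [ (λ x<0 → ⊥-elim (<-asym 0<xy (neg*pos x<0 0<y))) , (λ 0<x → 0<x , 0<y) ]′ (#⇒<⊎> x#0)
    where
    xy#0 = #-sym (<⇒# 0<xy)
    x#0  = x*y#0⇒x#0 xy#0
    0<y  = 0≤x∧x#0⇒0<x 0≤y (x*y#0⇒y#0 xy#0)

  *-monoˡ-≤ : 0# ≤ z → x ≤ y → z * x ≤ z * y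
  *-monoˡ-≤ {z} {x} {y} 0≤z x≤y = begin
    z * x                ≤⟨ x≤x+y (0≤x*y 0≤z (x≤y⇒0≤y-x x≤y)) ⟩
    z * x + z * (y - x)  ≈⟨ solve 3 (λ x y z → z :* x :+ z :* (y :+ :- x) := z :* y) refl x y z ⟩
    z * y                ∎

  *-monoˡ-< : 0# < z → x < y → z * x < z * y
  *-monoˡ-< {z} {x} {y} 0<z x<y = begin-strict
    z * x                <⟨ x<x+y (*-pos 0<z (x<y⇒0<y-x x<y)) ⟩
    z * x + z * (y - x)  ≈⟨ solve 3 (λ x y z → z :* x :+ z :* (y :+ :- x) := z :* y) refl x y z ⟩
    z * y                ∎

  *-cancelˡ-≤ : 0# < z → z * x ≤ z * y → x ≤ y
  *-cancelˡ-≤ 0<z zx≤zy = zx≤zy ∘ *-monoˡ-< 0<z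

  *-cancelˡ-< : 0# < z → z * x < z * y → x < y
  *-cancelˡ-< {z} {x} {y} 0<z zx<zy = begin-strict
    x              ≈⟨ +-identityʳ x ⟨
    x + 0#         <⟨ +-monoʳ-< x (proj₁ (0<x*y∧0≤y⇒0<x,0<y 0<[y-x]z (<⇒≤ 0<z))) ⟩
    x + (y - x)    ≈⟨ solve 2 (λ x y → x :+ (y :+ :- x) := y) refl x y ⟩
    y              ∎
    where
    0<[y-x]z : 0# < (y - x) * z
    0<[y-x]z = <-respʳ-≈
      (solve 3 (λ x y z → z :* y :+ :- (z :* x) := (y :+ :- x) :* z) refl x y z)
      (x<y⇒0<y-x zx<zy)

  *-cancelˡ-≈ : 0# < z → z * x ≈ z * y → x ≈ y
  *-cancelˡ-≈ 0<z zx≈zy = ≤-antisym (*-cancelˡ-≤ 0<z (≤-reflexive zx≈zy))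
                                    (*-cancelˡ-≤ 0<z (≤-reflexive (sym zx≈zy)))

  x#0⇒0<x*x : x # 0# → 0# < x * x
  x#0⇒0<x*x {x} x#0 with #⇒<⊎> x#0
  ... | inj₁ x<0 = <-respʳ-≈ (solve 1 (λ x → :- x :* :- x := x :* x) refl x)
                     (*-pos (x<0⇒0<-x x<0) (x<0⇒0<-x x<0))
  ... | inj₂ 0<x = *-pos 0<x 0<x

  0≤x*x : ∀ x → 0# ≤ x * x
  0≤x*x x xx<0 = <-asym xx<0 (x#0⇒0<x*x (x*y#0⇒x#0 (<⇒# xx<0)))

  0<1 : 0# < 1#
  0<1 = <-respʳ-≈ (*-identityˡ 1#) (x#0⇒0<x*x 1#0)

  -- Cotransitivity at `x + y` avoids a division by two.
  double-cancel-< : x + x < y + y → x < y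
  double-cancel-< {x} {y} x+x<y+y with <-cotrans x+x<y+y (x + y)
  ... | inj₁ x+x<x+y = +-cancelˡ-< x x+x<x+y
  ... | inj₂ x+y<y+y = +-cancelʳ-< y x+y<y+y

  double-cancel-≤ : x + x ≤ y + y → x ≤ y
  double-cancel-≤ x+x≤y+y y<x = x+x≤y+y (+-mono-< y<x y<x)

  x/y*y≈x : ∀ x {y} (y#0 : y # 0#) → x / y ⟨ y#0 ⟩ * y ≈ x
  x/y*y≈x x {y} y#0 with #⇒invertible y#0
  ... | y⁻¹ , y⁻¹*y≈1 , _ = begin-equality
    x * y⁻¹ * y           ≈⟨ solve 3 (λ x y y⁻¹ → x :* y⁻¹ :* y
                               := x :* (y⁻¹ :* (y :+ :- con (pos 0)))) refl x y y⁻¹ ⟩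
    x * (y⁻¹ * (y - 0#))  ≈⟨ *-congˡ y⁻¹*y≈1 ⟩
    x * 1#                ≈⟨ *-identityʳ x ⟩
    x                     ∎

  half : ∀ x → ∃[ h ] h + h ≈ x
  half x = x / 2 · 1# ⟨ 2#0 ⟩ , (begin-equality
    x / 2 · 1# ⟨ 2#0 ⟩ + x / 2 · 1# ⟨ 2#0 ⟩
      ≈⟨ solve 1 (λ h → h :+ h := h :* (con (pos 2))) refl _ ⟩
    x / 2 · 1# ⟨ 2#0 ⟩ * 2 · 1#
      ≈⟨ x/y*y≈x x 2#0 ⟩
    x
      ∎)
    where
    2#0 : 2 · 1# # 0#
    2#0 = #-sym (<⇒# (0<2·x 0<1))

  -- Were the meet also below `y`, then `y < x` would make `y` a lower bound exceeding the meet, so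
  -- `x ≤ y`; then `x` itself is such a lower bound, a contradiction.
  x∧y<x⇒y≤x∧y : x ∧ y < x → y ≤ x ∧ y
  x∧y<x⇒y≤x∧y {x} {y} x∧y<x x∧y<y = ∧-greatest ≤-refl x≤y x∧y<x
    where
    x≤y : x ≤ y
    x≤y y<x = ∧-greatest (<⇒≤ y<x) ≤-refl x∧y<y

  -- Constructively the meet need not be one of x and y, but it cannot be
  -- strictly below both.
  w<z*x∧w<z*y⇒w<z*[x∧y] : 0# < z → w < z * x → w < z * y → w < z * (x ∧ y)
  w<z*x∧w<z*y⇒w<z*[x∧y] {z} {w} {x} {y} 0<z w<zx w<zy
    with <-cotrans w<zx (z * (x ∧ y)) | <-cotrans w<zy (z * (x ∧ y))
  ... | inj₁ w<z[x∧y]  | _              = w<z[x∧y]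
  ... | inj₂ _         | inj₁ w<z[x∧y]  = w<z[x∧y]
  ... | inj₂ z[x∧y]<zx | inj₂ z[x∧y]<zy =
    ⊥-elim (x∧y<x⇒y≤x∧y (*-cancelˡ-< 0<z z[x∧y]<zx) (*-cancelˡ-< 0<z z[x∧y]<zy))

  x#y⇒x-y#0 : x # y → x - y # 0#
  x#y⇒x-y#0 {x} {y} x#y with #⇒<⊎> x#y
  ... | inj₁ x<y = <⇒# (<-respʳ-≈ (-‿inverseʳ y) (+-monoˡ-< (- y) x<y))
  ... | inj₂ y<x = x<y⇒y-x#0 y<x

  y*[x/y]≈x : ∀ x {y} (y#0 : y # 0#) → y * (x / y ⟨ y#0 ⟩) ≈ x
  y*[x/y]≈x x y#0 = trans (*-comm _ _) (x/y*y≈x x y#0)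

  -- The proof of apartness is independent of `0<y`, so that the lemmas apply to whichever proofs
  -- the quotients in the theorem carry.
  module _ {y#0 : y # 0#} (0<y : 0# < y) where

    x/y<z⇔x<y*z : x / y ⟨ y#0 ⟩ < z ⇔ x < y * z
    x/y<z⇔x<y*z = mk⇔
      (λ x/y<z → <-respˡ-≈ (y*[x/y]≈x _ y#0) (*-monoˡ-< 0<y x/y<z))
      (λ x<y*z → *-cancelˡ-< 0<y (<-respˡ-≈ (sym (y*[x/y]≈x _ y#0)) x<y*z))

    z<x/y⇔y*z<x : z < x / y ⟨ y#0 ⟩ ⇔ y * z < x
    z<x/y⇔y*z<x = mk⇔
      (λ z<x/y → <-respʳ-≈ (y*[x/y]≈x _ y#0) (*-monoˡ-< 0<y z<x/y))
      (λ y*z<x → *-cancelˡ-< 0<y (<-respʳ-≈ (sym (y*[x/y]≈x _ y#0)) y*z<x))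

  sum-mono-≤ : ∀ {n} {f g : Vector Carrier n} → (∀ i → f i ≤ g i) → sum f ≤ sum g
  sum-mono-≤ {zero}  f≤g = ≤-refl
  sum-mono-≤ {suc n} f≤g = +-mono-≤ (f≤g zero) (sum-mono-≤ (f≤g ∘ suc))

-- Equilibria of an arbitrary network and their uniqueness.

module EquilibriumProperties {c ℓ₁ ℓ₂} (ℝ : Reals c ℓ₁ ℓ₂)
                             (α₁ α₂ α₃ β₁ β₂ β₃ : Reals.Carrier ℝ) where

  open Reals ℝ
  open OrderedFieldProperties orderedField
  open Traffic ℝ α₁ α₂ α₃ β₁ β₂ β₃
  open CommutativeRing commutativeRing using (semiring)
  open Sum semiring using (sum-cong-≋; ∑-distrib-+; *-distribʳ-sum)
  open DecMembership (Fin._≟_ {5}) using (_∈?_)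
  open IntegerCoefficientSolver commutativeRing
  open ≤-Reasoning

  -- Marks the zeros left by unfolding: the ends of sums and of link lists, and the contributions of
  -- paths that avoid a link.
  o : ∀ {n} → Polynomial n
  o = con (pos 0)

  linkTime-cong : ∀ e {x y} → x ≈ y → linkTime e x ≈ linkTime e y
  linkTime-cong ab x≈y = +-congˡ (*-congˡ x≈y)
  linkTime-cong bd x≈y = +-congˡ (*-congˡ x≈y)
  linkTime-cong bc x≈y = +-congˡ (*-congˡ x≈y)
  linkTime-cong ac x≈y = +-congˡ (*-congˡ x≈y)
  linkTime-cong cd x≈y = +-congˡ (*-congˡ x≈y)

  if-congᵗ : ∀ b {x y z} → x ≈ y → (if b then x else z) ≈ (if b then y else z)
  if-congᵗ true  x≈y = x≈y
  if-congᵗ false x≈y = refl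

  module _ (N : Network) where

    linkFlow-cong : ∀ {f g} → (∀ p → f p ≈ g p) → ∀ e → linkFlow N f e ≈ linkFlow N g e
    linkFlow-cong f≈g e = sum-cong-≋ λ p → if-congᵗ (does (e ∈? lookup N p)) (f≈g p)

    pathTime-cong : ∀ {f g} → (∀ p → f p ≈ g p) → ∀ p → pathTime N f p ≈ pathTime N g p
    pathTime-cong {f} {g} f≈g p = go (lookup N p)
      where
      time : PathFlow N → List Link → Carrier
      time f es = foldr _+_ 0# (map (λ e → linkTime e (linkFlow N f e)) es)

      go : ∀ es → time f es ≈ time g es
      go []       = refl
      go (e ∷ es) = +-cong (linkTime-cong e (linkFlow-cong f≈g e)) (go es)

    totalTime : (f g : PathFlow N) → Carrier
    totalTime f g = sum λ p → g p * pathTime N f p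

    module _ {Q f T} (equilibrium : IsEquilibrium N Q f T) where

      private
        used   = proj₁ (proj₂ equilibrium)
        unused = proj₂ (proj₂ equilibrium)

      T≤pathTime : ∀ p → T ≤ pathTime N f p
      T≤pathTime p t<T = <-irrefl (used p λ fp≈0 → unused p fp≈0 t<T) t<T

      -- Complementary slackness. By tightness it suffices to refute apartness of the two sides;
      -- apartness makes the flow non-vanishing, so the time equals `T` after all.
      f*T≈f*pathTime : ∀ p → f p * T ≈ f p * pathTime N f p
      f*T≈f*pathTime p = proj₁ (tight _ _) λ fT#ft →
        #-irrefl (*-congˡ (sym (used p λ fp≈0 → #-irrefl
          (trans (trans (*-congʳ fp≈0) (zeroˡ _)) (sym (trans (*-congʳ fp≈0) (zeroˡ _))))
          fT#ft))) fT#ft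

      Q*T≈totalTime : Q * T ≈ totalTime f f
      Q*T≈totalTime = begin-equality
        Q * T                  ≈⟨ *-congʳ (proj₂ (proj₁ equilibrium)) ⟨
        sum f * T              ≈⟨ *-distribʳ-sum T f ⟩
        sum (λ p → f p * T)    ≈⟨ sum-cong-≋ f*T≈f*pathTime ⟩
        totalTime f f          ∎

      -- With `Q*T≈totalTime` this is the variational inequality for equilibria: at the times fixed
      -- by `f`, no redistribution of the traffic lowers the total.
      Q*T≤totalTime : ∀ {g} → IsFlow N Q g → Q * T ≤ totalTime f g
      Q*T≤totalTime {g} (0≤g , Σg≈Q) = begin
        Q * T                  ≈⟨ *-congʳ Σg≈Q ⟨
        sum g * T              ≈⟨ *-distribʳ-sum T g ⟩
        sum (λ p → g p * T)    ≤⟨ sum-mono-≤ (λ p → *-monoˡ-≤ (0≤g p) (T≤pathTime p)) ⟩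
        totalTime f g          ∎

    StrictlyMonotone : Set _
    StrictlyMonotone = ∀ f g p → f p # g p →
      0# < sum (λ q → (f q - g q) * (pathTime N f q - pathTime N g q))

    module _ {Q f g T T′} (monotone : StrictlyMonotone)
             (equilibrium : IsEquilibrium N Q f T) (equilibrium′ : IsEquilibrium N Q g T′) where

      -- Adding the variational inequalities of the two equilibria bounds the sum of the products of
      -- flow and time differences by zero. Strict monotonicity thus excludes `f p # g p`, and
      -- tightness turns this into equality.
      flow-unique : ∀ p → f p ≈ g p
      flow-unique p = proj₁ (tight _ _) λ fp#gp → <-irrefl refl (begin-strict
        Q * T + Q * T′
          ≤⟨ +-mono-≤ (Q*T≤totalTime equilibrium (proj₁ equilibrium′))
                      (Q*T≤totalTime equilibrium′ (proj₁ equilibrium)) ⟩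
        totalTime f g + totalTime g f
          <⟨ x<x+y (monotone f g p fp#gp) ⟩
        (totalTime f g + totalTime g f) + sum (λ q → (f q - g q) * (t q - t′ q))
          ≈⟨ +-congʳ (∑-distrib-+ (λ q → g q * t q) (λ q → f q * t′ q)) ⟨
        sum (λ q → g q * t q + f q * t′ q) + sum (λ q → (f q - g q) * (t q - t′ q))
          ≈⟨ ∑-distrib-+ (λ q → g q * t q + f q * t′ q) (λ q → (f q - g q) * (t q - t′ q)) ⟨
        sum (λ q → (g q * t q + f q * t′ q) + (f q - g q) * (t q - t′ q))
          ≈⟨ sum-cong-≋ (λ q → solve 4 (λ f g t t′ →
               (g :* t :+ f :* t′) :+ (f :- g) :* (t :- t′) := f :* t :+ g :* t′)
               refl (f q) (g q) (t q) (t′ q)) ⟩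
        sum (λ q → f q * t q + g q * t′ q)
          ≈⟨ ∑-distrib-+ (λ q → f q * t q) (λ q → g q * t′ q) ⟩
        totalTime f f + totalTime g g
          ≈⟨ +-cong (Q*T≈totalTime equilibrium) (Q*T≈totalTime equilibrium′) ⟨
        Q * T + Q * T′
          ∎)
        where
        t  = pathTime N f
        t′ = pathTime N g

      -- The flow determines the total time `Q * T`, so cancelling `Q` spares the search for a path
      -- that is in use.
      time-unique : 0# < Q → T ≈ T′
      time-unique 0<Q = *-cancelˡ-≈ 0<Q (begin-equality
        Q * T          ≈⟨ Q*T≈totalTime equilibrium ⟩
        totalTime f f  ≈⟨ sum-cong-≋ (λ p → *-cong (flow-unique p) (pathTime-cong flow-unique p)) ⟩
        totalTime g g  ≈⟨ Q*T≈totalTime equilibrium′ ⟨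
        Q * T′         ∎)

  -- Path times of `S` and `S⁺` in closed form.

  module _ (f : PathFlow S) where

    -- The filter defining `S` and the membership tests compute away, so the left side of the solver
    -- equation is the unfolded path time; likewise for the other paths.
    pathTime-S₀ : pathTime S f 0F ≈ (α₁ + β₁ * f 0F) + (α₂ + β₂ * f 0F)
    pathTime-S₀ = solve 5 (λ α₁ α₂ β₁ β₂ x →
      (α₁ :+ β₁ :* (x :+ (o :+ o))) :+ ((α₂ :+ β₂ :* (x :+ (o :+ o))) :+ o)
        := (α₁ :+ β₁ :* x) :+ (α₂ :+ β₂ :* x)) refl α₁ α₂ β₁ β₂ (f 0F)

    pathTime-S₁ : pathTime S f 1F ≈ (α₁ + β₁ * f 1F) + (α₂ + β₂ * f 1F)
    pathTime-S₁ = solve 5 (λ α₁ α₂ β₁ β₂ x →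
      (α₂ :+ β₂ :* (o :+ (x :+ o))) :+ ((α₁ :+ β₁ :* (o :+ (x :+ o))) :+ o)
        := (α₁ :+ β₁ :* x) :+ (α₂ :+ β₂ :* x)) refl α₁ α₂ β₁ β₂ (f 1F)

  module _ (f : PathFlow S⁺) where

    pathTime-S⁺₀ : pathTime S⁺ f 0F ≈ (α₁ + β₁ * (f 0F + f 2F)) + (α₂ + β₂ * f 0F)
    pathTime-S⁺₀ = solve 6 (λ α₁ α₂ β₁ β₂ x z →
      (α₁ :+ β₁ :* (x :+ (o :+ (z :+ o)))) :+ ((α₂ :+ β₂ :* (x :+ (o :+ (o :+ o)))) :+ o)
        := (α₁ :+ β₁ :* (x :+ z)) :+ (α₂ :+ β₂ :* x)) refl α₁ α₂ β₁ β₂ (f 0F) (f 2F)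

    pathTime-S⁺₁ : pathTime S⁺ f 1F ≈ (α₁ + β₁ * (f 1F + f 2F)) + (α₂ + β₂ * f 1F)
    pathTime-S⁺₁ = solve 6 (λ α₁ α₂ β₁ β₂ y z →
      (α₂ :+ β₂ :* (o :+ (y :+ (o :+ o)))) :+ ((α₁ :+ β₁ :* (o :+ (y :+ (z :+ o)))) :+ o)
        := (α₁ :+ β₁ :* (y :+ z)) :+ (α₂ :+ β₂ :* y)) refl α₁ α₂ β₁ β₂ (f 1F) (f 2F)

    pathTime-S⁺₂ : pathTime S⁺ f 2F ≈
      (α₁ + β₁ * (f 0F + f 2F)) + ((α₃ + β₃ * f 2F) + (α₁ + β₁ * (f 1F + f 2F)))
    pathTime-S⁺₂ = solve 7 (λ α₁ α₃ β₁ β₃ x y z →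
      (α₁ :+ β₁ :* (x :+ (o :+ (z :+ o)))) :+ ((α₃ :+ β₃ :* (o :+ (o :+ (z :+ o))))
        :+ ((α₁ :+ β₁ :* (o :+ (y :+ (z :+ o)))) :+ o))
        := (α₁ :+ β₁ :* (x :+ z)) :+ ((α₃ :+ β₃ :* z) :+ (α₁ :+ β₁ :* (y :+ z))))
      refl α₁ α₃ β₁ β₃ (f 0F) (f 1F) (f 2F)

  -- Strict monotonicity of the path times.

  module PositiveSlopes (0<β₁ : 0# < β₁) (0<β₂ : 0# < β₂) (0<β₃ : 0# < β₃) where

    0≤x*[y*y] : ∀ {x} y → 0# < x → 0# ≤ x * (y * y)
    0≤x*[y*y] y 0<x = 0≤x*y (<⇒≤ 0<x) (0≤x*x y)

    0<x*[y*y] : ∀ {x y} → 0# < x → y # 0# → 0# < x * (y * y)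
    0<x*[y*y] 0<x y#0 = *-pos 0<x (x#0⇒0<x*x y#0)

    monotone-S : StrictlyMonotone S
    monotone-S f g p fp#gp = <-respʳ-≈ (sym squares) (positive p fp#gp)
      where
      Δ : Path S → Carrier
      Δ p = f p - g p

      time-S₀ : pathTime S f 0F - pathTime S g 0F ≈ (β₁ + β₂) * Δ 0F
      time-S₀ = trans (+-cong (pathTime-S₀ f) (-‿cong (pathTime-S₀ g)))
        (solve 6 (λ α₁ α₂ β₁ β₂ x x′ →
          (α₁ :+ β₁ :* x :+ (α₂ :+ β₂ :* x)) :- (α₁ :+ β₁ :* x′ :+ (α₂ :+ β₂ :* x′))
            := (β₁ :+ β₂) :* (x :- x′)) refl α₁ α₂ β₁ β₂ (f 0F) (g 0F))

      time-S₁ : pathTime S f 1F - pathTime S g 1F ≈ (β₁ + β₂) * Δ 1F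
      time-S₁ = trans (+-cong (pathTime-S₁ f) (-‿cong (pathTime-S₁ g)))
        (solve 6 (λ α₁ α₂ β₁ β₂ x x′ →
          (α₁ :+ β₁ :* x :+ (α₂ :+ β₂ :* x)) :- (α₁ :+ β₁ :* x′ :+ (α₂ :+ β₂ :* x′))
            := (β₁ :+ β₂) :* (x :- x′)) refl α₁ α₂ β₁ β₂ (f 1F) (g 1F))

      squares : sum (λ q → Δ q * (pathTime S f q - pathTime S g q))
                ≈ (β₁ + β₂) * (Δ 0F * Δ 0F) + (β₁ + β₂) * (Δ 1F * Δ 1F)
      squares = trans (+-cong (*-congˡ time-S₀) (+-congʳ (*-congˡ time-S₁)))
        (solve 3 (λ b x y → x :* (b :* x) :+ (y :* (b :* y) :+ o)
          := b :* (x :* x) :+ b :* (y :* y)) refl (β₁ + β₂) (Δ 0F) (Δ 1F))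

      0<b = 0<x+y 0<β₁ 0<β₂

      positive : ∀ p → f p # g p →
        0# < (β₁ + β₂) * (Δ 0F * Δ 0F) + (β₁ + β₂) * (Δ 1F * Δ 1F)
      positive 0F f#g = <-≤-trans (0<x*[y*y] 0<b (x#y⇒x-y#0 f#g)) (x≤x+y (0≤x*[y*y] _ 0<b))
      positive 1F f#g = <-≤-trans (0<x*[y*y] 0<b (x#y⇒x-y#0 f#g))
        (≤-trans (x≤x+y (0≤x*[y*y] _ 0<b)) (≤-reflexive (+-comm _ _)))

    monotone-S⁺ : StrictlyMonotone S⁺
    monotone-S⁺ f g p fp#gp = <-respʳ-≈ (sym squares)
      (<-≤-trans (positive p fp#gp) (x≤x+y (0≤x+y (0≤x*[y*y] _ 0<β₁) (0≤x*[y*y] _ 0<β₁))))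
      where
      Δ : Path S⁺ → Carrier
      Δ p = f p - g p

      time-S⁺₀ : pathTime S⁺ f 0F - pathTime S⁺ g 0F ≈ β₁ * (Δ 0F + Δ 2F) + β₂ * Δ 0F
      time-S⁺₀ = trans (+-cong (pathTime-S⁺₀ f) (-‿cong (pathTime-S⁺₀ g)))
        (solve 8 (λ α₁ α₂ β₁ β₂ x z x′ z′ →
          ((α₁ :+ β₁ :* (x :+ z)) :+ (α₂ :+ β₂ :* x))
            :- ((α₁ :+ β₁ :* (x′ :+ z′)) :+ (α₂ :+ β₂ :* x′))
            := β₁ :* ((x :- x′) :+ (z :- z′)) :+ β₂ :* (x :- x′))
          refl α₁ α₂ β₁ β₂ (f 0F) (f 2F) (g 0F) (g 2F))

      time-S⁺₁ : pathTime S⁺ f 1F - pathTime S⁺ g 1F ≈ β₁ * (Δ 1F + Δ 2F) + β₂ * Δ 1F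
      time-S⁺₁ = trans (+-cong (pathTime-S⁺₁ f) (-‿cong (pathTime-S⁺₁ g)))
        (solve 8 (λ α₁ α₂ β₁ β₂ x z x′ z′ →
          ((α₁ :+ β₁ :* (x :+ z)) :+ (α₂ :+ β₂ :* x))
            :- ((α₁ :+ β₁ :* (x′ :+ z′)) :+ (α₂ :+ β₂ :* x′))
            := β₁ :* ((x :- x′) :+ (z :- z′)) :+ β₂ :* (x :- x′))
          refl α₁ α₂ β₁ β₂ (f 1F) (f 2F) (g 1F) (g 2F))

      time-S⁺₂ : pathTime S⁺ f 2F - pathTime S⁺ g 2F
                 ≈ β₁ * (Δ 0F + Δ 2F) + (β₃ * Δ 2F + β₁ * (Δ 1F + Δ 2F))
      time-S⁺₂ = trans (+-cong (pathTime-S⁺₂ f) (-‿cong (pathTime-S⁺₂ g)))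
        (solve 10 (λ α₁ α₃ β₁ β₃ x y z x′ y′ z′ →
          ((α₁ :+ β₁ :* (x :+ z)) :+ ((α₃ :+ β₃ :* z) :+ (α₁ :+ β₁ :* (y :+ z))))
            :- ((α₁ :+ β₁ :* (x′ :+ z′)) :+ ((α₃ :+ β₃ :* z′) :+ (α₁ :+ β₁ :* (y′ :+ z′))))
            := β₁ :* ((x :- x′) :+ (z :- z′))
               :+ (β₃ :* (z :- z′) :+ β₁ :* ((y :- y′) :+ (z :- z′))))
          refl α₁ α₃ β₁ β₃ (f 0F) (f 1F) (f 2F) (g 0F) (g 1F) (g 2F))

      A B C : Carrier
      A = β₂ * (Δ 0F * Δ 0F)
      B = β₂ * (Δ 1F * Δ 1F)
      C = β₃ * (Δ 2F * Δ 2F)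

      -- Regrouped by links, the sum is slope times squared change of link flow: `A`, `B`, `C`
      -- belong to `bd`, `ac`, `bc`, and the two terms with `β₁` to `ab` and `cd`.
      squares : sum (λ q → Δ q * (pathTime S⁺ f q - pathTime S⁺ g q))
        ≈ (A + (B + C)) + (β₁ * ((Δ 0F + Δ 2F) * (Δ 0F + Δ 2F))
                            + β₁ * ((Δ 1F + Δ 2F) * (Δ 1F + Δ 2F)))
      squares = trans
        (+-cong (*-congˡ time-S⁺₀) (+-cong (*-congˡ time-S⁺₁) (+-congʳ (*-congˡ time-S⁺₂))))
        (solve 6 (λ β₁ β₂ β₃ x y z →
          x :* (β₁ :* (x :+ z) :+ β₂ :* x)
            :+ (y :* (β₁ :* (y :+ z) :+ β₂ :* y)
            :+ (z :* (β₁ :* (x :+ z) :+ (β₃ :* z :+ β₁ :* (y :+ z))) :+ o))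
          := (β₂ :* (x :* x) :+ (β₂ :* (y :* y) :+ β₃ :* (z :* z)))
             :+ (β₁ :* ((x :+ z) :* (x :+ z)) :+ β₁ :* ((y :+ z) :* (y :+ z))))
          refl β₁ β₂ β₃ (Δ 0F) (Δ 1F) (Δ 2F))

      0≤A = 0≤x*[y*y] (Δ 0F) 0<β₂
      0≤B = 0≤x*[y*y] (Δ 1F) 0<β₂
      0≤C = 0≤x*[y*y] (Δ 2F) 0<β₃

      -- Each of `bd`, `ac`, `bc` lies on exactly one path, so a change on any path already shows in
      -- one of `A`, `B`, `C`.
      positive : ∀ p → f p # g p → 0# < A + (B + C)
      positive 0F f#g = <-≤-trans (0<x*[y*y] 0<β₂ (x#y⇒x-y#0 f#g)) (x≤x+y (0≤x+y 0≤B 0≤C))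
      positive 1F f#g = <-≤-trans (0<x*[y*y] 0<β₂ (x#y⇒x-y#0 f#g))
        (≤-trans (x≤x+y (0≤x+y 0≤A 0≤C)) (≤-reflexive
          (solve 3 (λ a b c → b :+ (a :+ c) := a :+ (b :+ c)) refl A B C)))
      positive 2F f#g = <-≤-trans (0<x*[y*y] 0<β₃ (x#y⇒x-y#0 f#g))
        (≤-trans (x≤x+y (0≤x+y 0≤A 0≤B)) (≤-reflexive
          (solve 3 (λ a b c → c :+ (a :+ b) := a :+ (b :+ c)) refl A B C)))

    -- The equilibrium on `S` and the identities that compare times.

    module TotalFlow {Q : Carrier} (0<Q : 0# < Q) where

      h = proj₁ (half Q)

      h+h≈Q : h + h ≈ Q
      h+h≈Q = proj₂ (half Q)

      0≤h : 0# ≤ h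
      0≤h = double-cancel-≤ (begin
        0# + 0#  ≈⟨ +-identityˡ 0# ⟩
        0#       ≤⟨ <⇒≤ 0<Q ⟩
        Q        ≈⟨ h+h≈Q ⟨
        h + h    ∎)

      T-S : Carrier
      T-S = (α₁ + β₁ * h) + (α₂ + β₂ * h)

      equilibrium-S : IsEquilibrium S Q (λ _ → h) T-S
      equilibrium-S = ((λ _ → 0≤h) , trans (+-congˡ (+-identityʳ h)) h+h≈Q)
                    , (λ p _ → time p) , (λ p _ → ≤-reflexive (sym (time p)))
        where
        time : ∀ p → pathTime S (λ _ → h) p ≈ T-S
        time 0F = pathTime-S₀ (λ _ → h)
        time 1F = pathTime-S₁ (λ _ → h)

      equilibriumTime-S : IsEquilibriumTime S Q T-S
      equilibriumTime-S = ((λ _ → h) , equilibrium-S) , λ f T′ equilibrium →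
        time-unique S monotone-S equilibrium equilibrium-S 0<Q

      -- For flows of total `Q` on `S⁺` with `y` on the third path, `γ` is the rate at which `y`
      -- lowers `t₀ + t₁ - 2 t₂`, and `η` the rate at which it raises `2 t₂`. The denominator of the
      -- lower bound, `κ` in names below, is `b + η`.
      δ b γ η : Carrier
      δ = α₂ - α₁ - α₃
      b = β₁ - β₂
      γ = β₁ + β₂ + (β₃ + β₃)
      η = (β₁ + β₃) + (β₁ + β₃)

      0<γ : 0# < γ
      0<γ = 0<x+y (0<x+y 0<β₁ 0<β₂) (0<x+y 0<β₃ 0<β₃)

      0<η : 0# < η
      0<η = 0<x+y (0<x+y 0<β₁ 0<β₃) (0<x+y 0<β₁ 0<β₃)

      γ+b≈η : γ + b ≈ η
      γ+b≈η = solve 3 (λ β₁ β₂ β₃ → (β₁ :+ β₂ :+ (β₃ :+ β₃)) :+ (β₁ :- β₂)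
        := (β₁ :+ β₃) :+ (β₁ :+ β₃)) refl β₁ β₂ β₃

      0<κ : β₂ < β₁ → 0# < 3 · β₁ + 2 · β₃ - β₂
      0<κ β₂<β₁ = <-respʳ-≈ (solve 3 (λ β₁ β₂ β₃ → (β₁ :- β₂) :+ ((β₁ :+ β₃) :+ (β₁ :+ β₃))
        := (β₁ :+ (β₁ :+ (β₁ :+ o))) :+ (β₃ :+ (β₃ :+ o)) :- β₂) refl β₁ β₂ β₃)
        (0<x+y (x<y⇒0<y-x β₂<β₁) 0<η)

      κ*Q≈b*Q+η*Q : (3 · β₁ + 2 · β₃ - β₂) * Q ≈ b * Q + η * Q
      κ*Q≈b*Q+η*Q = solve 4 (λ β₁ β₂ β₃ Q →
        ((β₁ :+ (β₁ :+ (β₁ :+ o))) :+ (β₃ :+ (β₃ :+ o)) :- β₂) :* Q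
          := (β₁ :- β₂) :* Q :+ ((β₁ :+ β₃) :+ (β₁ :+ β₃)) :* Q) refl β₁ β₂ β₃ Q

      module _ (f : PathFlow S⁺) (Σf≈Q : sum f ≈ Q) where

        private
          y  = f 2F
          t₀ = pathTime S⁺ f 0F
          t₁ = pathTime S⁺ f 1F
          t₂ = pathTime S⁺ f 2F

        -- Together `ab` and `cd` carry `Q + y`, while `bd` and `ac` carry `Q - y`; the effect of
        -- `y` is therefore `β₁ - β₂` per unit.
        t₀+t₁≈T+T+b*y : t₀ + t₁ ≈ (T-S + T-S) + b * y
        t₀+t₁≈T+T+b*y = begin-equality
          t₀ + t₁
            ≈⟨ +-cong (pathTime-S⁺₀ f) (pathTime-S⁺₁ f) ⟩
          ((α₁ + β₁ * (f 0F + y)) + (α₂ + β₂ * f 0F)) + ((α₁ + β₁ * (f 1F + y)) + (α₂ + β₂ * f 1F))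
            ≈⟨ solve 7 (λ α₁ α₂ β₁ β₂ u v y →
                 ((α₁ :+ β₁ :* (u :+ y)) :+ (α₂ :+ β₂ :* u))
                   :+ ((α₁ :+ β₁ :* (v :+ y)) :+ (α₂ :+ β₂ :* v))
                 := ((α₁ :+ α₂) :+ (α₁ :+ α₂)) :+ (β₁ :+ β₂) :* (u :+ (v :+ (y :+ o)))
                   :+ (β₁ :- β₂) :* y)
               refl α₁ α₂ β₁ β₂ (f 0F) (f 1F) y ⟩
          ((α₁ + α₂) + (α₁ + α₂)) + (β₁ + β₂) * sum f + b * y
            ≈⟨ +-congʳ (+-congˡ (*-congˡ (trans Σf≈Q (sym h+h≈Q)))) ⟩
          ((α₁ + α₂) + (α₁ + α₂)) + (β₁ + β₂) * (h + h) + b * y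
            ≈⟨ solve 6 (λ α₁ α₂ β₁ β₂ h z →
                 ((α₁ :+ α₂) :+ (α₁ :+ α₂)) :+ (β₁ :+ β₂) :* (h :+ h) :+ z
                 := (((α₁ :+ β₁ :* h) :+ (α₂ :+ β₂ :* h))
                   :+ ((α₁ :+ β₁ :* h) :+ (α₂ :+ β₂ :* h))) :+ z)
               refl α₁ α₂ β₁ β₂ h (b * y) ⟩
          (T-S + T-S) + b * y
            ∎

        -- The third path shares `ab` with the first and `cd` with the second, so `t₀ + t₁ - 2 t₂`
        -- weighs `bd` and `ac` against `ab`, `cd` and twice `bc`.
        b*Q+γ*y+t₀+t₁≈2δ+t₂+t₂ : (b * Q + γ * y) + (t₀ + t₁) ≈ 2 · δ + (t₂ + t₂)
        b*Q+γ*y+t₀+t₁≈2δ+t₂+t₂ = begin-equality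
          (b * Q + γ * y) + (t₀ + t₁)
            ≈⟨ +-cong (+-congʳ (*-congˡ (sym Σf≈Q))) (+-cong (pathTime-S⁺₀ f) (pathTime-S⁺₁ f)) ⟩
          (b * sum f + γ * y)
            + (((α₁ + β₁ * (f 0F + y)) + (α₂ + β₂ * f 0F)) + ((α₁ + β₁ * (f 1F + y)) + (α₂ + β₂ * f 1F)))
            ≈⟨ solve 9 (λ α₁ α₂ α₃ β₁ β₂ β₃ u v y →
                 ((β₁ :- β₂) :* (u :+ (v :+ (y :+ o))) :+ (β₁ :+ β₂ :+ (β₃ :+ β₃)) :* y)
                   :+ (((α₁ :+ β₁ :* (u :+ y)) :+ (α₂ :+ β₂ :* u))
                   :+ ((α₁ :+ β₁ :* (v :+ y)) :+ (α₂ :+ β₂ :* v)))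
                 := ((α₂ :- α₁ :- α₃) :+ ((α₂ :- α₁ :- α₃) :+ o))
                   :+ (((α₁ :+ β₁ :* (u :+ y)) :+ ((α₃ :+ β₃ :* y) :+ (α₁ :+ β₁ :* (v :+ y))))
                   :+ ((α₁ :+ β₁ :* (u :+ y)) :+ ((α₃ :+ β₃ :* y) :+ (α₁ :+ β₁ :* (v :+ y))))))
               refl α₁ α₂ α₃ β₁ β₂ β₃ (f 0F) (f 1F) y ⟩
          2 · δ + (((α₁ + β₁ * (f 0F + y)) + ((α₃ + β₃ * y) + (α₁ + β₁ * (f 1F + y))))
            + ((α₁ + β₁ * (f 0F + y)) + ((α₃ + β₃ * y) + (α₁ + β₁ * (f 1F + y)))))
            ≈⟨ +-congˡ (+-cong (pathTime-S⁺₂ f) (pathTime-S⁺₂ f)) ⟨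
          2 · δ + (t₂ + t₂)
            ∎

        -- Eliminating `t₀ + t₁` makes the gap between `t₂` and `T-S` depend on the flow only
        -- through `y`.
        2δ+t₂+t₂≈b*Q+η*y+T+T : 2 · δ + (t₂ + t₂) ≈ (b * Q + η * y) + (T-S + T-S)
        2δ+t₂+t₂≈b*Q+η*y+T+T = begin-equality
          2 · δ + (t₂ + t₂)                            ≈⟨ b*Q+γ*y+t₀+t₁≈2δ+t₂+t₂ ⟨
          (b * Q + γ * y) + (t₀ + t₁)                  ≈⟨ +-congˡ t₀+t₁≈T+T+b*y ⟩
          (b * Q + γ * y) + ((T-S + T-S) + b * y)      ≈⟨ solve 5 (λ q γ y T b →
            (q :+ γ :* y) :+ (T :+ b :* y) := (q :+ (γ :+ b) :* y) :+ T)
            refl (b * Q) γ y (T-S + T-S) b ⟩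
          (b * Q + (γ + b) * y) + (T-S + T-S)          ≈⟨ +-congʳ (+-congˡ (*-congʳ γ+b≈η)) ⟩
          (b * Q + η * y) + (T-S + T-S)                ∎

      -- Bounds on `Q` forced by the paradox.

      module Necessity {f : PathFlow S⁺} {T⁺} (equilibrium : IsEquilibrium S⁺ Q f T⁺)
               (T<T⁺ : T-S < T⁺) where

        private
          0≤f  = proj₁ (proj₁ equilibrium)
          Σf≈Q = proj₂ (proj₁ equilibrium)
          y  = f 2F
          t₀ = pathTime S⁺ f 0F
          t₁ = pathTime S⁺ f 1F
          t₂ = pathTime S⁺ f 2F

        0<b*y : 0# < b * y
        0<b*y = +-cancelˡ-< (T-S + T-S) (begin-strict
          (T-S + T-S) + 0#       ≈⟨ +-identityʳ _ ⟩
          T-S + T-S              <⟨ +-mono-< T<T⁺ T<T⁺ ⟩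
          T⁺ + T⁺                ≤⟨ +-mono-≤ (T≤pathTime S⁺ equilibrium 0F) (T≤pathTime S⁺ equilibrium 1F) ⟩
          t₀ + t₁                ≈⟨ t₀+t₁≈T+T+b*y f Σf≈Q ⟩
          (T-S + T-S) + b * y    ∎)

        0<b : 0# < b
        0<b = proj₁ (0<x*y∧0≤y⇒0<x,0<y 0<b*y (0≤f 2F))

        0<y : 0# < y
        0<y = proj₂ (0<x*y∧0≤y⇒0<x,0<y 0<b*y (0≤f 2F))

        t₂≈T⁺ : t₂ ≈ T⁺
        t₂≈T⁺ = proj₁ (proj₂ equilibrium) 2F (λ y≈0 → <-irrefl (sym y≈0) 0<y)

        β₂<β₁ : β₂ < β₁
        β₂<β₁ = +-cancelʳ-< (- β₂) (<-respˡ-≈ (sym (-‿inverseʳ β₂)) 0<b)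

        y≤Q : y ≤ Q
        y≤Q = begin
          y                     ≤⟨ x≤x+y (0≤x+y (0≤f 0F) (0≤f 1F)) ⟩
          y + (f 0F + f 1F)     ≈⟨ solve 3 (λ u v y → y :+ (u :+ v) := u :+ (v :+ (y :+ o)))
                                     refl (f 0F) (f 1F) y ⟩
          sum f                 ≈⟨ Σf≈Q ⟩
          Q                     ∎

        -- As `t₂` is the equilibrium time, it is at most `t₀` and `t₁`, which leaves
        -- `b * Q + γ * y ≤ 2 · δ`; the positive term `γ * y` gives strictness.
        b*Q<2δ : b * Q < 2 · δ
        b*Q<2δ = <-≤-trans (x<x+y (*-pos 0<γ 0<y)) (+-cancelʳ-≤ (t₂ + t₂) (begin
          (b * Q + γ * y) + (t₂ + t₂)  ≤⟨ +-mono-≤ ≤-refl (+-mono-≤ (t₂≤t 0F) (t₂≤t 1F)) ⟩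
          (b * Q + γ * y) + (t₀ + t₁)  ≈⟨ b*Q+γ*y+t₀+t₁≈2δ+t₂+t₂ f Σf≈Q ⟩
          2 · δ + (t₂ + t₂)            ∎))
          where
          t₂≤t : ∀ p → t₂ ≤ pathTime S⁺ f p
          t₂≤t p = ≤-trans (≤-reflexive t₂≈T⁺) (T≤pathTime S⁺ equilibrium p)

        -- From `T-S < t₂` comes `2 · δ < b * Q + η * y`, and `y` is at most `Q`.
        2δ<κ*Q : 2 · δ < (3 · β₁ + 2 · β₃ - β₂) * Q
        2δ<κ*Q = begin-strict
          2 · δ            <⟨ +-cancelʳ-< (T-S + T-S) 2δ+T+T<b*Q+η*y+T+T ⟩
          b * Q + η * y    ≤⟨ +-mono-≤ ≤-refl (*-monoˡ-≤ (<⇒≤ 0<η) y≤Q) ⟩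
          b * Q + η * Q    ≈⟨ κ*Q≈b*Q+η*Q ⟨
          (3 · β₁ + 2 · β₃ - β₂) * Q  ∎
          where
          T<t₂ : T-S < t₂
          T<t₂ = <-respʳ-≈ (sym t₂≈T⁺) T<T⁺

          2δ+T+T<b*Q+η*y+T+T : 2 · δ + (T-S + T-S) < (b * Q + η * y) + (T-S + T-S)
          2δ+T+T<b*Q+η*y+T+T = begin-strict
            2 · δ + (T-S + T-S)            <⟨ +-monoʳ-< (2 · δ) (+-mono-< T<t₂ T<t₂) ⟩
            2 · δ + (t₂ + t₂)              ≈⟨ 2δ+t₂+t₂≈b*Q+η*y+T+T f Σf≈Q ⟩
            (b * Q + η * y) + (T-S + T-S)  ∎

      -- An equilibrium on `S⁺` that is slower than the one on `S`.

      module Sufficiency (0<b : 0# < b) (2δ<κ*Q : 2 · δ < (3 · β₁ + 2 · β₃ - β₂) * Q)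
               (b*Q<2δ : b * Q < 2 · δ) where

        γ#0 : γ # 0#
        γ#0 = #-sym (<⇒# 0<γ)

        -- ŷ is the flow on P₃ at which, with the rest of Q split evenly between
        -- P₁ and P₂, all three paths take the same time.  It may exceed Q, in
        -- which case all traffic goes along P₃.
        ŷ y x : Carrier
        ŷ = (2 · δ - b * Q) / γ ⟨ γ#0 ⟩
        y = ŷ ∧ Q
        x = proj₁ (half (Q - y))

        x+x≈Q-y : x + x ≈ Q - y
        x+x≈Q-y = proj₂ (half (Q - y))

        γ*ŷ≈2δ-b*Q : γ * ŷ ≈ 2 · δ - b * Q
        γ*ŷ≈2δ-b*Q = y*[x/y]≈x _ γ#0

        0<2δ-b*Q : 0# < 2 · δ - b * Q
        0<2δ-b*Q = x<y⇒0<y-x b*Q<2δ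

        0<ŷ : 0# < ŷ
        0<ŷ = *-cancelˡ-< 0<γ (begin-strict
          γ * 0#           ≈⟨ zeroʳ γ ⟩
          0#               <⟨ 0<2δ-b*Q ⟩
          2 · δ - b * Q    ≈⟨ γ*ŷ≈2δ-b*Q ⟨
          γ * ŷ            ∎)

        -- It is checked at both arguments of the meet: at `ŷ` the surplus of `η` over `γ` is `b`,
        -- and at `Q` it is the lower bound on `Q`.
        2δ-b*Q<η*y : 2 · δ - b * Q < η * y
        2δ-b*Q<η*y = w<z*x∧w<z*y⇒w<z*[x∧y] 0<η
          (begin-strict
            2 · δ - b * Q    ≈⟨ γ*ŷ≈2δ-b*Q ⟨
            γ * ŷ            <⟨ x<x+y (*-pos 0<b 0<ŷ) ⟩
            γ * ŷ + b * ŷ    ≈⟨ distribʳ ŷ γ b ⟨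
            (γ + b) * ŷ      ≈⟨ *-congʳ γ+b≈η ⟩
            η * ŷ            ∎)
          (+-cancelˡ-< (b * Q) (begin-strict
            b * Q + (2 · δ - b * Q)       ≈⟨ solve 2 (λ q d → q :+ (d :- q) := d) refl (b * Q) (2 · δ) ⟩
            2 · δ                         <⟨ 2δ<κ*Q ⟩
            (3 · β₁ + 2 · β₃ - β₂) * Q    ≈⟨ κ*Q≈b*Q+η*Q ⟩
            b * Q + η * Q                 ∎))

        0<y : 0# < y
        0<y = *-cancelˡ-< 0<η (begin-strict
          η * 0#           ≈⟨ zeroʳ η ⟩
          0#               <⟨ 0<2δ-b*Q ⟩
          2 · δ - b * Q    <⟨ 2δ-b*Q<η*y ⟩
          η * y            ∎)

        0≤x : 0# ≤ x
        0≤x = double-cancel-≤ (begin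
          0# + 0#  ≈⟨ +-identityˡ 0# ⟩
          0#       ≤⟨ x≤y⇒0≤y-x (x∧y≤y ŷ Q) ⟩
          Q - y    ≈⟨ x+x≈Q-y ⟨
          x + x    ∎)

        f⁺ : PathFlow S⁺
        f⁺ 0F = x
        f⁺ 1F = x
        f⁺ 2F = y

        0≤f⁺ : ∀ p → 0# ≤ f⁺ p
        0≤f⁺ 0F = 0≤x
        0≤f⁺ 1F = 0≤x
        0≤f⁺ 2F = <⇒≤ 0<y

        Σf⁺≈Q : sum f⁺ ≈ Q
        Σf⁺≈Q = begin-equality
          x + (x + (y + 0#))  ≈⟨ solve 2 (λ x y → x :+ (x :+ (y :+ o)) := (x :+ x) :+ y) refl x y ⟩
          (x + x) + y         ≈⟨ +-congʳ x+x≈Q-y ⟩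
          (Q - y) + y         ≈⟨ solve 2 (λ Q y → (Q :- y) :+ y := Q) refl Q y ⟩
          Q                   ∎

        private
          t₀ = pathTime S⁺ f⁺ 0F
          t₁ = pathTime S⁺ f⁺ 1F
          T⁺ = pathTime S⁺ f⁺ 2F

        t₁≈t₀ : t₁ ≈ t₀
        t₁≈t₀ = trans (pathTime-S⁺₁ f⁺) (sym (pathTime-S⁺₀ f⁺))

        b*Q+γ*ŷ≈2δ : b * Q + γ * ŷ ≈ 2 · δ
        b*Q+γ*ŷ≈2δ = trans (+-congˡ γ*ŷ≈2δ-b*Q)
          (solve 2 (λ q d → q :+ (d :- q) := d) refl (b * Q) (2 · δ))

        -- At `ŷ` the second identity would balance exactly; cutting off to `y ≤ ŷ` can only favour
        -- the third path.
        T⁺≤t₀ : T⁺ ≤ t₀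
        T⁺≤t₀ = double-cancel-≤ (+-cancelʳ-≤ (2 · δ) (begin
          (T⁺ + T⁺) + 2 · δ             ≈⟨ +-comm _ _ ⟩
          2 · δ + (T⁺ + T⁺)             ≈⟨ b*Q+γ*y+t₀+t₁≈2δ+t₂+t₂ f⁺ Σf⁺≈Q ⟨
          (b * Q + γ * y) + (t₀ + t₁)   ≤⟨ +-mono-≤ (+-mono-≤ ≤-refl (*-monoˡ-≤ (<⇒≤ 0<γ) (x∧y≤x ŷ Q)))
                                             (+-mono-≤ ≤-refl (≤-reflexive t₁≈t₀)) ⟩
          (b * Q + γ * ŷ) + (t₀ + t₀)   ≈⟨ +-congʳ b*Q+γ*ŷ≈2δ ⟩
          2 · δ + (t₀ + t₀)             ≈⟨ +-comm _ _ ⟩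
          (t₀ + t₀) + 2 · δ             ∎))

        T⁺<t₀⇒y<ŷ : T⁺ < t₀ → y < ŷ
        T⁺<t₀⇒y<ŷ T⁺<t₀ = *-cancelˡ-< 0<γ (+-cancelˡ-< (b * Q) (+-cancelʳ-< (T⁺ + T⁺) (begin-strict
          (b * Q + γ * y) + (T⁺ + T⁺)  <⟨ +-monoʳ-< _ (+-mono-< T⁺<t₀ (<-respʳ-≈ (sym t₁≈t₀) T⁺<t₀)) ⟩
          (b * Q + γ * y) + (t₀ + t₁)  ≈⟨ b*Q+γ*y+t₀+t₁≈2δ+t₂+t₂ f⁺ Σf⁺≈Q ⟩
          2 · δ + (T⁺ + T⁺)            ≈⟨ +-congʳ b*Q+γ*ŷ≈2δ ⟨
          (b * Q + γ * ŷ) + (T⁺ + T⁺)  ∎)))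

        -- If `t₀` exceeded `T⁺`, then `y` would be strictly below `ŷ`, so the cut-off at `Q` would
        -- be active and nothing would remain for the outer paths, against `x` being non-zero.
        t₀≈T⁺ : ¬ (x ≈ 0#) → t₀ ≈ T⁺
        t₀≈T⁺ x≉0 = ≤-antisym (λ T⁺<t₀ → x≉0 (≤-antisym (x≤0 T⁺<t₀) 0≤x)) T⁺≤t₀
          where
          x≤0 : T⁺ < t₀ → x ≤ 0#
          x≤0 T⁺<t₀ = double-cancel-≤ (begin
            x + x    ≈⟨ x+x≈Q-y ⟩
            Q - y    ≤⟨ +-mono-≤ (x∧y<x⇒y≤x∧y (T⁺<t₀⇒y<ŷ T⁺<t₀)) ≤-refl ⟩
            y - y    ≈⟨ -‿inverseʳ y ⟩
            0#       ≈⟨ +-identityˡ 0# ⟨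
            0# + 0#  ∎)

        equilibrium-S⁺ : IsEquilibrium S⁺ Q f⁺ T⁺
        equilibrium-S⁺ = (0≤f⁺ , Σf⁺≈Q) , used , λ p _ → T⁺≤t p
          where
          used : ∀ p → ¬ (f⁺ p ≈ 0#) → pathTime S⁺ f⁺ p ≈ T⁺
          used 0F x≉0 = t₀≈T⁺ x≉0
          used 1F x≉0 = trans t₁≈t₀ (t₀≈T⁺ x≉0)
          used 2F _   = refl

          T⁺≤t : ∀ p → T⁺ ≤ pathTime S⁺ f⁺ p
          T⁺≤t 0F = T⁺≤t₀
          T⁺≤t 1F = ≤-trans T⁺≤t₀ (≤-reflexive (sym t₁≈t₀))
          T⁺≤t 2F = ≤-refl

        T<T⁺ : T-S < T⁺
        T<T⁺ = double-cancel-< (+-cancelˡ-< (2 · δ) (begin-strict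
          2 · δ + (T-S + T-S)            <⟨ +-monoˡ-< (T-S + T-S) 2δ<b*Q+η*y ⟩
          (b * Q + η * y) + (T-S + T-S)  ≈⟨ 2δ+t₂+t₂≈b*Q+η*y+T+T f⁺ Σf⁺≈Q ⟨
          2 · δ + (T⁺ + T⁺)              ∎))
          where
          2δ<b*Q+η*y : 2 · δ < b * Q + η * y
          2δ<b*Q+η*y = begin-strict
            2 · δ                      ≈⟨ solve 2 (λ q d → d := q :+ (d :- q)) refl (b * Q) (2 · δ) ⟩
            b * Q + (2 · δ - b * Q)    <⟨ +-monoʳ-< (b * Q) 2δ-b*Q<η*y ⟩
            b * Q + η * y              ∎

        braessParadox : BraessParadox Q
        braessParadox = T-S , T⁺ , equilibriumTime-S
          , ((f⁺ , equilibrium-S⁺) , λ f T′ equilibrium →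
              time-unique S⁺ monotone-S⁺ equilibrium equilibrium-S⁺ 0<Q)
          , T<T⁺

corollary2 : ∀ {c ℓ₁ ℓ₂} (ℝ : Reals c ℓ₁ ℓ₂) →
  let open Reals ℝ in
  (α₁ α₂ α₃ β₁ β₂ β₃ Q : Carrier) →
  0# ≤ α₁ → 0# ≤ α₂ → 0# ≤ α₃ →
  (0<β₁ : 0# < β₁) (0<β₂ : 0# < β₂) (0<β₃ : 0# < β₃) →
  0# < Q →
  Traffic.BraessParadox ℝ α₁ α₂ α₃ β₁ β₂ β₃ Q ⇔
    (Σ[ β₂<β₁ ∈ β₂ < β₁ ]
      ((2 · (α₂ - α₁ - α₃)) / (3 · β₁ + 2 · β₃ - β₂) ⟨ 3·x+2·z-y#0 0<β₁ 0<β₃ β₂<β₁ ⟩ < Q) ×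
      (Q < (2 · (α₂ - α₁ - α₃)) / (β₁ - β₂) ⟨ x<y⇒y-x#0 β₂<β₁ ⟩))
corollary2 ℝ α₁ α₂ α₃ β₁ β₂ β₃ Q _ _ _ 0<β₁ 0<β₂ 0<β₃ 0<Q = mk⇔
  (λ (T , T⁺ , (_ , T-unique) , ((_ , equilibrium) , _) , T<T⁺) →
    -- The time for `S` that comes with the paradox is replaced by `T-S`, to which it is equal by
    -- uniqueness.
    let open Necessity equilibrium (<-respˡ-≈ (sym (T-unique _ T-S equilibrium-S)) T<T⁺) in
    β₂<β₁ , from (x/y<z⇔x<y*z (0<κ β₂<β₁)) 2δ<κ*Q , from (z<x/y⇔y*z<x 0<b) b*Q<2δ)
  (λ (β₂<β₁ , lower , upper) →
    let 0<b = x<y⇒0<y-x β₂<β₁ in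
    Sufficiency.braessParadox 0<b
      (to (x/y<z⇔x<y*z (0<κ β₂<β₁)) lower) (to (z<x/y⇔y*z<x 0<b) upper))
  where
  open Reals ℝ
  open Equivalence
  open OrderedFieldProperties orderedField
  open Traffic ℝ α₁ α₂ α₃ β₁ β₂ β₃
  open EquilibriumProperties ℝ α₁ α₂ α₃ β₁ β₂ β₃
  open PositiveSlopes 0<β₁ 0<β₂ 0<β₃
  open TotalFlow 0<Q
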